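{- Let $\mathbf{w}\in\mathcal{K}_{m+}\subset\mathbb{R}^n$. For every $\mathbf{v}\in\mathbb{R}^n$, $$\mathrm{prox}_{\Omega_{\mathbf{w}}}(\mathbf{v})=\mathrm{sign}(\mathbf{v})\odot\Bigl(\mathbf{P}(|\mathbf{v}|)^T\,\mathrm{proj}_{\mathbb{R}_+^n}\bigl(\mathrm{proj}_{\mathcal{K}_m}(|\mathbf{v}|_{\downarrow}-\mathbf{w})\bigr)\Bigr).$$
   Context: $\mathcal{K}_{m+}=\{\mathbf{x}\in\mathbb{R}^n: x_1\ge x_2\ge\cdots\ge x_n\ge 0\}$ is the monotone non-negative cone and $\mathcal{K}_m=\{\mathbf{x}\in\mathbb{R}^n:x_1\ge x_2\ge\cdots\ge x_n\}$ is the monotone cone. For $\mathbf{x}\in\mathbb{R}^n$, $|\mathbf{x}|$ is the vector of absolute values of its components, $|\mathbf{x}|_{\downarrow}$ is that vector sorted in non-increasing order, and $\mathbf{P}(|\mathbf{x}|)$ is a permutation matrix (ties broken arbitrarily) such that $|\mathbf{x}|_{\downarrow}=\mathbf{P}(|\mathbf{x}|)\,|\mathbf{x}|$. The ordered weighted $\ell_1$ (OWL) norm is $\Omega_{\mathbf{w}}(\mathbf{x})=\mathbf{w}^T|\mathbf{x}|_{\downarrow}$, and its proximity operator is $\mathrm{prox}_{\Omega_{\mathbf{w}}}(\mathbf{v})=\arg\min_{\mathbf{x}\in\mathbb{R}^n}\tfrac12\|\mathbf{x}-\mathbf{v}\|_2^2+\Omega_{\mathbf{w}}(\mathbf{x})$.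 $\mathrm{proj}_C$ denotes the Euclidean projection onto a closed convex set $C$ (for $C=\mathbb{R}^n_+$, component-wise clipping at zero); $\mathrm{sign}$ is applied component-wise and $\odot$ is the entry-wise product. -}

module Defs where

open import Algebra.Bundles using (CommutativeRing)
open import Data.Bool.Base using (if_then_else_)
open import Data.Fin.Base as Fin using (Fin; cast)
import Data.Fin.Properties as Fin
open import Data.Fin.Permutation using (Permutation′; _⟨$⟩ʳ_)
import Data.List.Base as List
open import Data.List.Properties using (length-tabulate)
open import Data.List.Relation.Binary.Permutation.Propositional.Properties using (↭-length)
import Data.List.Sort as Sort
open import Data.Nat.Base using (ℕ)
open import Data.Product.Base using (∃; _×_; proj₁; _,_)
open import Data.Sum.Base using (inj₁; inj₂)
open import Data.Vec.Functional using (Vector; map; zipWith; transpose)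
open import Level using (Level; suc; _⊔_)
open import Relation.Binary.Bundles using (DecTotalOrder)
open import Relation.Binary.Core using (Rel)
open import Relation.Binary.PropositionalEquality.Core as ≡ using (_≡_)
import Relation.Binary.Properties.DecTotalOrder as DecTotalOrderProperties
open import Relation.Binary.Structures using (IsDecTotalOrder)
open import Relation.Nullary.Decidable.Core using (does)
open import Relation.Nullary.Negation.Core using (¬_)
open import Relation.Unary using (Pred; U; _∩_; Satisfiable)

-- ℝ, axiomatised as a Dedekind-complete totally ordered field.  These axioms
-- are the classical ones (in particular the order is decidable) and determine
-- ℝ up to isomorphism.

record Reals (c ℓ₁ ℓ₂ : Level) : Set (suc (c ⊔ ℓ₁ ⊔ ℓ₂)) where
  infix 4 _≤_
  field
    commutativeRing : CommutativeRing c ℓ₁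

  open CommutativeRing commutativeRing public

  field
    _≤_             : Rel Carrier ℓ₂
    isDecTotalOrder : IsDecTotalOrder _≈_ _≤_
    0≉1             : ¬ 0# ≈ 1#
    inverse         : ∀ x → ¬ x ≈ 0# → ∃ λ y → x * y ≈ 1#
    +-monoˡ-≤       : ∀ z {x y} → x ≤ y → x + z ≤ y + z
    *-nonNeg        : ∀ {x y} → 0# ≤ x → 0# ≤ y → 0# ≤ x * y

  UpperBound : ∀ {p} → Pred Carrier p → Pred Carrier (c ⊔ ℓ₂ ⊔ p)
  UpperBound S b = ∀ x → S x → x ≤ b

  field
    supremum : (S : Pred Carrier (c ⊔ ℓ₁ ⊔ ℓ₂)) →
               Satisfiable S → Satisfiable (UpperBound S) →
               ∃ λ s → UpperBound S s × (∀ b → UpperBound S b → s ≤ b)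

  decTotalOrder : DecTotalOrder c ℓ₁ ℓ₂
  decTotalOrder = record { isDecTotalOrder = isDecTotalOrder }

  open IsDecTotalOrder isDecTotalOrder public
    using (_≤?_; _≟_; total; antisym; ≤-resp-≈; ≤-respˡ-≈; ≤-respʳ-≈)
    renaming (refl to ≤-refl; trans to ≤-trans; reflexive to ≤-reflexive)

module OWL {c ℓ₁ ℓ₂} (ℝ : Reals c ℓ₁ ℓ₂) where

  open Reals ℝ hiding (zero)
  open import Algebra.Properties.CommutativeMonoid.Sum +-commutativeMonoid public using (sum)
  open import Algebra.Properties.Ring ring using (-1*x≈-x; -‿involutive)
  open import Data.Vec.Functional.Relation.Binary.Equality.Setoid setoid public using (_≋_)

  0≤1 : 0# ≤ 1#
  0≤1 with total 0# 1#
  ... | inj₁ 0≤1 = 0≤1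
  ... | inj₂ 1≤0 = ≤-respʳ-≈ -1²≈1 (*-nonNeg 0≤-1 0≤-1)
    where
    0≤-1 : 0# ≤ - 1#
    0≤-1 = ≤-respˡ-≈ (-‿inverseʳ 1#) (≤-respʳ-≈ (+-identityˡ (- 1#)) (+-monoˡ-≤ (- 1#) 1≤0))
    -1²≈1 : - 1# * - 1# ≈ 1#
    -1²≈1 = trans (-1*x≈-x (- 1#)) (-‿involutive 1#)

  2≉0 : ¬ 1# + 1# ≈ 0#
  2≉0 2≈0 = 0≉1 (antisym 0≤1 (≤-respʳ-≈ 2≈0 (≤-respˡ-≈ (+-identityˡ 1#) (+-monoˡ-≤ 1# 0≤1))))

  ½ : Carrier
  ½ = proj₁ (inverse (1# + 1#) 2≉0)

  abs : Carrier → Carrier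
  abs x = if does (0# ≤? x) then x else - x

  sgn : Carrier → Carrier
  sgn x = if does (x ≟ 0#) then 0# else if does (0# ≤? x) then 1# else - 1#

  ℝ^ : ℕ → Set c
  ℝ^ n = Vector Carrier n

  private variable
    n : ℕ

  infixl 6 _-ᵥ_
  infixl 7 _⊙_
  infix  8 _∙_

  _-ᵥ_ _⊙_ : ℝ^ n → ℝ^ n → ℝ^ n
  _-ᵥ_ = zipWith _-_
  _⊙_  = zipWith _*_

  _∙_ : ℝ^ n → ℝ^ n → Carrier
  x ∙ y = sum (x ⊙ y)

  ‖_‖² : ℝ^ n → Carrier
  ‖ x ‖² = x ∙ x

  ∣_∣ sign : ℝ^ n → ℝ^ n
  ∣_∣  = map abs
  sign = map sgn

  open Sort (DecTotalOrderProperties.≥-decTotalOrder decTotalOrder) public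
    using (sort; sort-↭; sort-↗)

  length-sort-tabulate : (x : ℝ^ n) → n ≡ List.length (sort (List.tabulate x))
  length-sort-tabulate x = ≡.sym (≡.trans (↭-length (sort-↭ (List.tabulate x))) (length-tabulate x))

  -- `sort` is taken for the order _≥_, so the result is non-increasing.
  infix 9 _↓
  _↓ : ℝ^ n → ℝ^ n
  (x ↓) i = List.lookup (sort (List.tabulate x)) (cast (length-sort-tabulate x) i)

  Matrix : ℕ → ℕ → Set c
  Matrix m n = Vector (ℝ^ n) m

  infixr 7 _*ᵥ_
  infix  9 _ᵀ

  _*ᵥ_ : ∀ {m n} → Matrix m n → ℝ^ n → ℝ^ m
  (A *ᵥ x) i = A i ∙ x

  _ᵀ : ∀ {m n} → Matrix m n → Matrix n m
  _ᵀ = transpose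

  permutationMatrix : Permutation′ n → Matrix n n
  permutationMatrix π i j = if does ((π ⟨$⟩ʳ i) Fin.≟ j) then 1# else 0#

  IsPermutationMatrix : Matrix n n → Set ℓ₁
  IsPermutationMatrix P = ∃ λ π → ∀ i j → P i j ≈ permutationMatrix π i j

  𝒦ₘ ℝ₊ 𝒦ₘ₊ : Pred (ℝ^ n) ℓ₂
  𝒦ₘ x = ∀ {i j} → i Fin.≤ j → x j ≤ x i
  ℝ₊ x = ∀ i → 0# ≤ x i
  𝒦ₘ₊  = 𝒦ₘ ∩ ℝ₊

  IsArgMin : ∀ {p} → Pred (ℝ^ n) p → (ℝ^ n → Carrier) → Pred (ℝ^ n) (c ⊔ ℓ₂ ⊔ p)
  IsArgMin C f x = C x × (∀ y → C y → f x ≤ f y)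

  -- p is the Euclidean projection of z onto C.  (Minimising the distance and
  -- minimising its square are the same.)
  IsProj : ∀ {p} → Pred (ℝ^ n) p → ℝ^ n → Pred (ℝ^ n) (c ⊔ ℓ₂ ⊔ p)
  IsProj C z = IsArgMin C (λ x → ‖ x -ᵥ z ‖²)

  Ω : ℝ^ n → ℝ^ n → Carrier
  Ω w x = w ∙ ∣ x ∣ ↓

  IsProx : (ℝ^ n → Carrier) → ℝ^ n → Pred (ℝ^ n) (c ⊔ ℓ₂)
  IsProx g v = IsArgMin U (λ x → ½ * ‖ x -ᵥ v ‖² + g x)

{-# OPTIONS --safe #-}

-- Write a = |v|↓, z = a - w and let p⁺ be the positive part of the projection
-- p of z.  Put f x = ½ ‖x - v‖² + Ω x and g u = ½ ‖u - a‖² + w ∙ u.  By the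
-- rearrangement inequality f y ≥ g (|y|↓) for all y, and f x ≤ g p⁺ for the
-- claimed minimizer x.  On 𝒦ₘ₊ the function g is minimized by p⁺: for u ∈ 𝒦ₘ₊
-- the point p + (u - p⁺) still lies in 𝒦ₘ, so comparing it with p suffices and
-- no variational inequality for projections is needed.  Uniqueness follows from
-- strict convexity of f, tested at midpoints.

module Submission where

open import Defs
import Algebra.Properties.AbelianGroup as AbelianGroupProperties
import Algebra.Properties.Group as GroupProperties
import Algebra.Properties.Ring as RingProperties
import Algebra.Properties.Semiring.Mult as Mult
import Algebra.Properties.Semiring.Sum as SemiringSum
import Algebra.Solver.Ring as RingSolver
open import Algebra.Bundles using (CommutativeRing)
open import Algebra.Solver.Ring.AlmostCommutativeRing
  using (fromCommutativeRing; _-Raw-AlmostCommutative⟶_)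
open import Data.Bool.Base using (if_then_else_)
open import Data.Fin.Base as Fin using (Fin; zero; suc; cast; punchIn)
import Data.Fin.Properties as Fin
open import Data.Fin.Permutation using
  (Permutation′; _⟨$⟩ʳ_; _⟨$⟩ˡ_; _∘ₚ_; flip; cast-id; remove; punchIn-permute; inverseˡ; inverseʳ)
import Data.Integer.Base as ℤ
import Data.List.Base as List
import Data.List.Properties as List
open import Data.List.Relation.Binary.Permutation.Homogeneous using (onIndices)
open import Data.List.Relation.Binary.Permutation.Propositional using (↭⇒↭ₛ)
import Data.List.Relation.Binary.Permutation.Setoid.Properties as ↭ₛ
import Data.List.Relation.Unary.Sorted.TotalOrder.Properties as Sorted
open import Data.Maybe.Base as Maybe using (Maybe)
open import Data.Nat.Base as ℕ using (ℕ; zero; suc; z≤n; s≤s)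
import Data.Nat.Properties as ℕ
open import Data.Product.Base using (∃; _×_; _,_; proj₁; proj₂)
open import Data.Sum.Base using (_⊎_; inj₁; inj₂)
open import Data.Vec.Functional using (removeAt)
open import Function.Base using (_∘_)
open import Function.Bundles using (_⇔_; mk⇔)
open import Level using (Level; _⊔_)
open import Relation.Binary.Bundles using (DecTotalOrder)
open import Relation.Binary.PropositionalEquality.Core as ≡ using (_≡_; _≢_)
import Relation.Binary.PropositionalEquality.Properties as ≡
import Relation.Binary.Properties.DecTotalOrder as DecTotalOrderProperties
import Relation.Binary.Reasoning.PartialOrder as PartialOrderReasoning
import Relation.Binary.Reasoning.Setoid as ≈-Reasoning
open import Relation.Nullary.Decidable using (dec-true; dec-false)
open import Relation.Nullary.Decidable.Core using (dec⇒maybe; does; yes; no)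
open import Relation.Nullary.Negation.Core using (contradiction)

-- A ring solver with coefficients in ℤ: with coefficients in an abstract ring,
-- cancellations such as x - x would not compute.
module IntegerCoefficients {c ℓ} (R : CommutativeRing c ℓ) where
  open ℤ using (ℤ; +_; -[1+_]; _⊖_)
  import Data.Integer.Properties as ℤ
  open CommutativeRing R
  open AbelianGroupProperties +-abelianGroup using (⁻¹-∙-comm)
  open GroupProperties +-group using (ε⁻¹≈ε; ⁻¹-involutive)
  open RingProperties ring using (-‿distribˡ-*; -‿distribʳ-*)
  open Mult semiring using (×-homo-+; ×1-homo-*; ×-homo-1) renaming (_×_ to _·_)
  open ≈-Reasoning setoid

  ⟦_⟧ℕ : ℕ → Carrier
  ⟦ n ⟧ℕ = n · 1#

  ⟦_⟧ : ℤ → Carrier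
  ⟦ + n ⟧      = ⟦ n ⟧ℕ
  ⟦ -[1+ n ] ⟧ = - ⟦ suc n ⟧ℕ

  -‿homo : ∀ i → ⟦ ℤ.- i ⟧ ≈ - ⟦ i ⟧
  -‿homo (+ zero)   = sym ε⁻¹≈ε
  -‿homo (+ suc n)  = refl
  -‿homo (-[1+ n ]) = sym (⁻¹-involutive _)

  x-y≈[z+x]-[z+y] : ∀ x y z → x - y ≈ (z + x) - (z + y)
  x-y≈[z+x]-[z+y] x y z = begin
    x - y                   ≈⟨ +-identityˡ _ ⟨
    0# + (x - y)            ≈⟨ +-congʳ (-‿inverseʳ z) ⟨
    (z - z) + (x - y)       ≈⟨ +-assoc _ _ _ ⟩
    z + (- z + (x - y))     ≈⟨ +-congˡ (+-assoc _ _ _) ⟨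
    z + ((- z + x) - y)     ≈⟨ +-congˡ (+-congʳ (+-comm _ _)) ⟩
    z + ((x - z) - y)       ≈⟨ +-congˡ (+-assoc _ _ _) ⟩
    z + (x + (- z - y))     ≈⟨ +-assoc _ _ _ ⟨
    (z + x) + (- z - y)     ≈⟨ +-congˡ (⁻¹-∙-comm z y) ⟩
    (z + x) - (z + y)       ∎

  ⊖-homo : ∀ m n → ⟦ m ⊖ n ⟧ ≈ ⟦ m ⟧ℕ - ⟦ n ⟧ℕ
  ⊖-homo m       zero    = sym (trans (+-congˡ ε⁻¹≈ε) (+-identityʳ _))
  ⊖-homo zero    (suc n) = sym (+-identityˡ _)
  ⊖-homo (suc m) (suc n) = begin
    ⟦ suc m ⊖ suc n ⟧         ≡⟨ ≡.cong ⟦_⟧ (ℤ.[1+m]⊖[1+n]≡m⊖n m n) ⟩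
    ⟦ m ⊖ n ⟧                 ≈⟨ ⊖-homo m n ⟩
    ⟦ m ⟧ℕ - ⟦ n ⟧ℕ           ≈⟨ x-y≈[z+x]-[z+y] _ _ 1# ⟩
    ⟦ suc m ⟧ℕ - ⟦ suc n ⟧ℕ   ∎

  +-homo : ∀ i j → ⟦ i ℤ.+ j ⟧ ≈ ⟦ i ⟧ + ⟦ j ⟧
  +-homo (+ m)      (+ n)      = ×-homo-+ 1# m n
  +-homo (+ m)      (-[1+ n ]) = ⊖-homo m (suc n)
  +-homo (-[1+ m ]) (+ n)      = trans (⊖-homo n (suc m)) (+-comm _ _)
  +-homo (-[1+ m ]) (-[1+ n ]) = begin
    - ⟦ suc (suc (m ℕ.+ n)) ⟧ℕ       ≡⟨ ≡.cong (λ k → - ⟦ suc k ⟧ℕ) (ℕ.+-suc m n) ⟨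
    - ⟦ suc m ℕ.+ suc n ⟧ℕ           ≈⟨ -‿cong (×-homo-+ 1# (suc m) (suc n)) ⟩
    - (⟦ suc m ⟧ℕ + ⟦ suc n ⟧ℕ)      ≈⟨ ⁻¹-∙-comm _ _ ⟨
    - ⟦ suc m ⟧ℕ - ⟦ suc n ⟧ℕ        ∎

  *-homo-negʳ : ∀ m n → ⟦ + m ℤ.* -[1+ n ] ⟧ ≈ ⟦ m ⟧ℕ * - ⟦ suc n ⟧ℕ
  *-homo-negʳ m n = begin
    ⟦ + m ℤ.* -[1+ n ] ⟧         ≡⟨ ≡.cong ⟦_⟧ (ℤ.-◃n≡-n (m ℕ.* suc n)) ⟩
    ⟦ ℤ.- (+ (m ℕ.* suc n)) ⟧    ≈⟨ -‿homo (+ (m ℕ.* suc n)) ⟩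
    - ⟦ m ℕ.* suc n ⟧ℕ           ≈⟨ -‿cong (×1-homo-* m (suc n)) ⟩
    - (⟦ m ⟧ℕ * ⟦ suc n ⟧ℕ)      ≈⟨ -‿distribʳ-* _ _ ⟩
    ⟦ m ⟧ℕ * - ⟦ suc n ⟧ℕ        ∎

  *-homo : ∀ i j → ⟦ i ℤ.* j ⟧ ≈ ⟦ i ⟧ * ⟦ j ⟧
  *-homo (+ m)      (+ n)      = begin
    ⟦ + m ℤ.* + n ⟧   ≡⟨ ≡.cong ⟦_⟧ (ℤ.pos-* m n) ⟨
    ⟦ m ℕ.* n ⟧ℕ      ≈⟨ ×1-homo-* m n ⟩
    ⟦ m ⟧ℕ * ⟦ n ⟧ℕ   ∎
  *-homo (+ m)      (-[1+ n ]) = *-homo-negʳ m n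
  *-homo (-[1+ m ]) (+ n)      = begin
    ⟦ -[1+ m ] ℤ.* + n ⟧       ≡⟨ ≡.cong ⟦_⟧ (ℤ.*-comm -[1+ m ] (+ n)) ⟩
    ⟦ + n ℤ.* -[1+ m ] ⟧       ≈⟨ *-homo-negʳ n m ⟩
    ⟦ n ⟧ℕ * - ⟦ suc m ⟧ℕ      ≈⟨ *-comm _ _ ⟩
    - ⟦ suc m ⟧ℕ * ⟦ n ⟧ℕ      ∎
  *-homo (-[1+ m ]) (-[1+ n ]) = begin
    ⟦ suc m ℕ.* suc n ⟧ℕ              ≈⟨ ×1-homo-* (suc m) (suc n) ⟩
    ⟦ suc m ⟧ℕ * ⟦ suc n ⟧ℕ           ≈⟨ ⁻¹-involutive _ ⟨
    - - (⟦ suc m ⟧ℕ * ⟦ suc n ⟧ℕ)     ≈⟨ -‿cong (-‿distribʳ-* _ _) ⟩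
    - (⟦ suc m ⟧ℕ * - ⟦ suc n ⟧ℕ)     ≈⟨ -‿distribˡ-* _ _ ⟩
    - ⟦ suc m ⟧ℕ * - ⟦ suc n ⟧ℕ       ∎

  morphism : ℤ.+-*-rawRing -Raw-AlmostCommutative⟶ fromCommutativeRing R
  morphism = record
    { ⟦_⟧    = ⟦_⟧
    ; +-homo = +-homo
    ; *-homo = *-homo
    ; -‿homo = -‿homo
    ; 0-homo = refl
    ; 1-homo = ×-homo-1 1#
    }

  _coeff≟_ : ∀ i j → Maybe (⟦ i ⟧ ≈ ⟦ j ⟧)
  i coeff≟ j = Maybe.map (λ i≡j → reflexive (≡.cong ⟦_⟧ i≡j)) (dec⇒maybe (i ℤ.≟ j))

  open RingSolver ℤ.+-*-rawRing (fromCommutativeRing R) morphism _coeff≟_ public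
    using (solve; _:=_; _:+_; _:*_; _:-_; :-_)

-- Order, squares and halves in an ordered field.

module OrderedField {c ℓ₁ ℓ₂} (ℝ : Reals c ℓ₁ ℓ₂) where
  open Reals ℝ hiding (zero)
  open OWL ℝ
  open IntegerCoefficients commutativeRing using (solve; _:=_; _:+_; _:*_; _:-_; :-_)
  open RingProperties ring using (-1*x≈-x)
  open PartialOrderReasoning (DecTotalOrder.poset decTotalOrder)

  +-monoʳ-≤ : ∀ z {x y} → x ≤ y → z + x ≤ z + y
  +-monoʳ-≤ z {x} {y} x≤y = begin
    z + x  ≈⟨ +-comm z x ⟩
    x + z  ≤⟨ +-monoˡ-≤ z x≤y ⟩
    y + z  ≈⟨ +-comm y z ⟩
    z + y  ∎

  +-mono-≤ : ∀ {x y u v} → x ≤ y → u ≤ v → x + u ≤ y + v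
  +-mono-≤ {y = y} {u = u} x≤y u≤v = ≤-trans (+-monoˡ-≤ u x≤y) (+-monoʳ-≤ y u≤v)

  +-cancelˡ-≤ : ∀ z {x y} → z + x ≤ z + y → x ≤ y
  +-cancelˡ-≤ z {x} {y} z+x≤z+y = begin
    x            ≈⟨ solve 2 (λ z x → x := :- z :+ (z :+ x)) refl z x ⟩
    - z + (z + x)  ≤⟨ +-monoʳ-≤ (- z) z+x≤z+y ⟩
    - z + (z + y)  ≈⟨ solve 2 (λ z y → :- z :+ (z :+ y) := y) refl z y ⟩
    y            ∎

  ≤⇒0≤- : ∀ {x y} → x ≤ y → 0# ≤ y - x
  ≤⇒0≤- {x} {y} x≤y = ≤-respˡ-≈ (-‿inverseʳ x) (+-monoˡ-≤ (- x) x≤y)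

  -- Reduces an inequality to a nonnegative gap `d` and an identity; most estimates below take this
  -- form and leave the identity to the ring solver.
  x+d≈y⇒x≤y : ∀ {x y d} → 0# ≤ d → x + d ≈ y → x ≤ y
  x+d≈y⇒x≤y {x} {y} {d} 0≤d x+d≈y = begin
    x       ≈⟨ +-identityʳ x ⟨
    x + 0#  ≤⟨ +-monoʳ-≤ x 0≤d ⟩
    x + d   ≈⟨ x+d≈y ⟩
    y       ∎

  +-nonNeg : ∀ {x y} → 0# ≤ x → 0# ≤ y → 0# ≤ x + y
  +-nonNeg 0≤x 0≤y = ≤-respˡ-≈ (+-identityˡ 0#) (+-mono-≤ 0≤x 0≤y)

  neg-antimono-≤ : ∀ {x y} → x ≤ y → - y ≤ - x
  neg-antimono-≤ {x} {y} x≤y =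
    x+d≈y⇒x≤y (≤⇒0≤- x≤y) (solve 2 (λ x y → :- y :+ (y :- x) := :- x) refl x y)

  0≤-x : ∀ {x} → x ≤ 0# → 0# ≤ - x
  0≤-x {x} x≤0 = ≤-respʳ-≈ (+-identityˡ (- x)) (≤⇒0≤- x≤0)

  *-monoˡ-≤-nonNeg : ∀ {z x y} → 0# ≤ z → x ≤ y → z * x ≤ z * y
  *-monoˡ-≤-nonNeg {z} {x} {y} 0≤z x≤y = x+d≈y⇒x≤y (*-nonNeg 0≤z (≤⇒0≤- x≤y))
    (solve 3 (λ z x y → z :* x :+ z :* (y :- x) := z :* y) refl z x y)

  0≤x² : ∀ x → 0# ≤ x * x
  0≤x² x with total 0# x
  ... | inj₁ 0≤x = *-nonNeg 0≤x 0≤x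
  ... | inj₂ x≤0 = ≤-respʳ-≈ (solve 1 (λ x → :- x :* :- x := x :* x) refl x)
                             (*-nonNeg (0≤-x x≤0) (0≤-x x≤0))

  -- An inverse `y` of `x` gives `x ≈ x * x * y`, and `x * x` vanishes because squares are
  -- nonnegative.
  x²≤0⇒x≈0 : ∀ {x} → x * x ≤ 0# → x ≈ 0#
  x²≤0⇒x≈0 {x} x²≤0 with x ≟ 0#
  ... | yes x≈0 = x≈0
  ... | no  x≉0 with y , xy≈1 ← inverse x x≉0 = begin-equality
    x            ≈⟨ *-identityʳ x ⟨
    x * 1#       ≈⟨ *-congˡ xy≈1 ⟨
    x * (x * y)  ≈⟨ *-assoc x x y ⟨
    x * x * y    ≈⟨ *-congʳ (antisym x²≤0 (0≤x² x)) ⟩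
    0# * y       ≈⟨ zeroˡ y ⟩
    0#           ∎

  x-y≈0⇒x≈y : ∀ {x y} → x - y ≈ 0# → x ≈ y
  x-y≈0⇒x≈y {x} {y} x-y≈0 = trans (solve 2 (λ x y → x := (x :- y) :+ y) refl x y)
                                  (trans (+-congʳ x-y≈0) (+-identityˡ y))

  ½+½≈1 : ½ + ½ ≈ 1#
  ½+½≈1 = trans (sym (trans (distribʳ ½ 1# 1#) (+-cong (*-identityˡ ½) (*-identityˡ ½))))
                (proj₂ (inverse (1# + 1#) 2≉0))

  ½x+½x≈x : ∀ x → ½ * x + ½ * x ≈ x
  ½x+½x≈x x = trans (sym (distribʳ x ½ ½)) (trans (*-congʳ ½+½≈1) (*-identityˡ x))

  ½[x+x]≈x : ∀ x → ½ * (x + x) ≈ x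
  ½[x+x]≈x x = trans (distribˡ ½ x x) (½x+½x≈x x)

  0≤½ : 0# ≤ ½
  -- `½` is the sum of two copies of its own square.
  0≤½ = ≤-respʳ-≈ (½x+½x≈x ½) (+-nonNeg (0≤x² ½) (0≤x² ½))

  -- Absolute values.

  abs-split : ∀ x → (0# ≤ x × abs x ≡ x) ⊎ (x ≤ 0# × abs x ≡ - x)
  abs-split x with 0# ≤? x
  ... | yes 0≤x = inj₁ (0≤x , ≡.refl)
  ... | no  0≰x with total 0# x
  ...   | inj₁ 0≤x = contradiction 0≤x 0≰x
  ...   | inj₂ x≤0 = inj₂ (x≤0 , ≡.refl)

  0≤abs : ∀ x → 0# ≤ abs x
  0≤abs x with abs-split x
  ... | inj₁ (0≤x , eq) rewrite eq = 0≤x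
  ... | inj₂ (x≤0 , eq) rewrite eq = 0≤-x x≤0

  x≤abs : ∀ x → x ≤ abs x
  x≤abs x with abs-split x
  ... | inj₁ (0≤x , eq) rewrite eq = ≤-refl
  ... | inj₂ (x≤0 , eq) rewrite eq = ≤-trans x≤0 (0≤-x x≤0)

  -x≤abs : ∀ x → - x ≤ abs x
  -x≤abs x with abs-split x
  ... | inj₁ (0≤x , eq) rewrite eq = begin
    - x   ≤⟨ neg-antimono-≤ 0≤x ⟩
    - 0#  ≈⟨ trans (sym (+-identityˡ (- 0#))) (-‿inverseʳ 0#) ⟩
    0#    ≤⟨ 0≤x ⟩
    x     ∎
  ... | inj₂ (x≤0 , eq) rewrite eq = ≤-refl

  -- Together with `x≤abs` and `-x≤abs` this characterises `abs x` as the maximum of `x` and `- x`,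
  -- so `abs` can be evaluated up to `≈` without following its defining test.
  abs-least : ∀ {x b} → x ≤ b → - x ≤ b → abs x ≤ b
  abs-least {x} x≤b -x≤b with abs-split x
  ... | inj₁ (_ , eq) rewrite eq = x≤b
  ... | inj₂ (_ , eq) rewrite eq = -x≤b

  0≤x⇒abs≈x : ∀ {x} → 0# ≤ x → abs x ≈ x
  0≤x⇒abs≈x {x} 0≤x = antisym (abs-least ≤-refl (≤-trans (x+d≈y⇒x≤y 0≤x (-‿inverseˡ x)) 0≤x)) (x≤abs x)

  x≤0⇒abs≈-x : ∀ {x} → x ≤ 0# → abs x ≈ - x
  x≤0⇒abs≈-x {x} x≤0 = antisym (abs-least (≤-trans x≤0 (0≤-x x≤0)) ≤-refl) (-x≤abs x)

  abs-square : ∀ x → abs x * abs x ≈ x * x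
  abs-square x with abs-split x
  ... | inj₁ (_ , eq) rewrite eq = refl
  ... | inj₂ (_ , eq) rewrite eq = solve 1 (λ x → :- x :* :- x := x :* x) refl x

  xy≤absxabsy : ∀ x y → x * y ≤ abs x * abs y
  xy≤absxabsy x y with abs-split x
  ... | inj₁ (0≤x , eq) rewrite eq = *-monoˡ-≤-nonNeg 0≤x (x≤abs y)
  ... | inj₂ (x≤0 , eq) rewrite eq =
    ≤-respˡ-≈ (solve 2 (λ x y → :- x :* :- y := x :* y) refl x y)
              (*-monoˡ-≤-nonNeg (0≤-x x≤0) (-x≤abs y))

  -- Both sides expand to the same squares by `abs-square`; the gap is twice the nonnegative number
  -- `d`.
  [absx-absy]²≤[x-y]² : ∀ x y → (abs x - abs y) * (abs x - abs y) ≤ (x - y) * (x - y)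
  [absx-absy]²≤[x-y]² x y = x+d≈y⇒x≤y (+-nonNeg 0≤d 0≤d) (begin-equality
    (X - Y) * (X - Y) + (d + d)
      ≈⟨ solve 3 (λ X Y z →
           (X :- Y) :* (X :- Y) :+ ((X :* Y :- z) :+ (X :* Y :- z))
           := X :* X :+ Y :* Y :- (z :+ z)) refl X Y (x * y) ⟩
    X * X + Y * Y - (x * y + x * y)
      ≈⟨ +-congʳ (+-cong (abs-square x) (abs-square y)) ⟩
    x * x + y * y - (x * y + x * y)
      ≈⟨ solve 2 (λ x y → x :* x :+ y :* y :- (x :* y :+ x :* y) := (x :- y) :* (x :- y)) refl x y ⟩
    (x - y) * (x - y)
      ∎)
    where
    X = abs x
    Y = abs y
    d = X * Y - x * y
    0≤d : 0# ≤ d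
    0≤d = ≤⇒0≤- (xy≤absxabsy x y)

  -- Midpoint convexity of `abs`, doubled to avoid a division: `abs m + abs m` is the sum `x + y` or
  -- its negative, and either is bounded term by term.
  abs-midpoint : ∀ {m x y} → m + m ≈ x + y → abs m + abs m ≤ abs x + abs y
  abs-midpoint {m} {x} {y} 2m≈x+y with abs-split m
  ... | inj₁ (_ , eq) rewrite eq = begin
    m + m          ≈⟨ 2m≈x+y ⟩
    x + y          ≤⟨ +-mono-≤ (x≤abs x) (x≤abs y) ⟩
    abs x + abs y  ∎
  ... | inj₂ (_ , eq) rewrite eq = begin
    - m + - m      ≈⟨ solve 1 (λ m → :- m :+ :- m := :- (m :+ m)) refl m ⟩
    - (m + m)      ≈⟨ -‿cong 2m≈x+y ⟩
    - (x + y)      ≈⟨ solve 2 (λ x y → :- (x :+ y) := :- x :+ :- y) refl x y ⟩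
    - x + - y      ≤⟨ +-mono-≤ (-x≤abs x) (-x≤abs y) ⟩
    abs x + abs y  ∎

  -- Signs, and the effect of restoring the sign of an entry.

  data SignOf (x : Carrier) : Carrier → Set (c ⊔ ℓ₁ ⊔ ℓ₂) where
    isZero   : x ≈ 0# → SignOf x 0#
    isNonNeg : 0# ≤ x → SignOf x 1#
    isNonPos : x ≤ 0# → SignOf x (- 1#)

  signOf : ∀ x → SignOf x (sgn x)
  signOf x with x ≟ 0#
  ... | yes x≈0 = isZero x≈0
  ... | no  _   with 0# ≤? x
  ...   | yes 0≤x = isNonNeg 0≤x
  ...   | no  0≰x with total 0# x
  ...     | inj₁ 0≤x = contradiction 0≤x 0≰x
  ...     | inj₂ x≤0 = isNonPos x≤0

  -- Equality can fail only where `v` is zero, since `sgn v` then annihilates `b`.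
  abs-sgn* : ∀ v {x b} → 0# ≤ b → x ≈ sgn v * b → abs x ≤ b
  abs-sgn* v {x} {b} 0≤b x≈sb = abs-least
    (≤-respˡ-≈ (sym x≈sb) (sb≤b (signOf v)))
    (≤-respˡ-≈ (-‿cong (sym x≈sb)) (-sb≤b (signOf v)))
    where
    -b≤b : - b ≤ b
    -b≤b = ≤-trans (-x≤abs b) (≤-reflexive (0≤x⇒abs≈x 0≤b))
    sb≤b : ∀ {s} → SignOf v s → s * b ≤ b
    sb≤b (isZero   _) = ≤-respˡ-≈ (sym (zeroˡ b)) 0≤b
    sb≤b (isNonNeg _) = ≤-reflexive (*-identityˡ b)
    sb≤b (isNonPos _) = ≤-respˡ-≈ (sym (-1*x≈-x b)) -b≤b
    -sb≤b : ∀ {s} → SignOf v s → - (s * b) ≤ b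
    -sb≤b (isZero   _) = ≤-respˡ-≈ (solve 2 (λ z b → :- b :* z := :- (z :* b)) refl 0# b)
                           (≤-respˡ-≈ (sym (zeroʳ (- b))) 0≤b)
    -sb≤b (isNonNeg _) = ≤-respˡ-≈ (-‿cong (sym (*-identityˡ b))) -b≤b
    -sb≤b (isNonPos _) = ≤-reflexive (trans (-‿cong (-1*x≈-x b)) (solve 1 (λ b → :- (:- b) := b) refl b))

  square-cong : ∀ {x y} → x ≈ y → x * x ≈ y * y
  square-cong x≈y = *-cong x≈y x≈y

  -- For `sgn v` equal to `1#` or `- 1#` the two sides agree, as `v` is its sign times its modulus.
  -- For zero `v` the left side vanishes.
  [sgn*-v]²≤[b-absv]² : ∀ v {x b a} → x ≈ sgn v * b → a ≈ abs v →
                        (x - v) * (x - v) ≤ (b - a) * (b - a)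
  [sgn*-v]²≤[b-absv]² v {x} {b} {a} x≈sb a≈absv =
    ≤-respˡ-≈ (square-cong (+-congʳ (sym x≈sb))) (bound (signOf v))
    where
    bound : ∀ {s} → SignOf v s → (s * b - v) * (s * b - v) ≤ (b - a) * (b - a)
    bound (isZero v≈0) = begin
      (0# * b - v) * (0# * b - v)  ≈⟨ square-cong (+-cong (zeroˡ b) (-‿cong v≈0)) ⟩
      (0# - 0#) * (0# - 0#)        ≈⟨ *-congʳ (-‿inverseʳ 0#) ⟩
      0# * (0# - 0#)               ≈⟨ zeroˡ _ ⟩
      0#                           ≤⟨ 0≤x² (b - a) ⟩
      (b - a) * (b - a)            ∎
    bound (isNonNeg 0≤v) = ≤-reflexive (square-cong
      (+-cong (*-identityˡ b) (-‿cong (sym (trans a≈absv (0≤x⇒abs≈x 0≤v))))))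
    bound (isNonPos v≤0) = begin
      (- 1# * b - v) * (- 1# * b - v)  ≈⟨ square-cong (+-congʳ (-1*x≈-x b)) ⟩
      (- b - v) * (- b - v)            ≈⟨ solve 2 (λ b v → (:- b :- v) :* (:- b :- v) := (b :- (:- v)) :* (b :- (:- v))) refl b v ⟩
      (b - - v) * (b - - v)            ≈⟨ square-cong (+-congˡ (-‿cong (trans a≈absv (x≤0⇒abs≈-x v≤0)))) ⟨
      (b - a) * (b - a)                ∎

  -- The positive part, which is the projection onto the nonnegative half-line.

  pos : Carrier → Carrier
  pos x = if does (0# ≤? x) then x else 0#

  pos-split : ∀ x → (0# ≤ x × pos x ≡ x) ⊎ (x ≤ 0# × pos x ≡ 0#)
  pos-split x with 0# ≤? x
  ... | yes 0≤x = inj₁ (0≤x , ≡.refl)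
  ... | no  0≰x with total 0# x
  ...   | inj₁ 0≤x = contradiction 0≤x 0≰x
  ...   | inj₂ x≤0 = inj₂ (x≤0 , ≡.refl)

  0≤pos : ∀ x → 0# ≤ pos x
  0≤pos x with pos-split x
  ... | inj₁ (0≤x , eq) rewrite eq = 0≤x
  ... | inj₂ (_   , eq) rewrite eq = ≤-refl

  x≤pos : ∀ x → x ≤ pos x
  x≤pos x with pos-split x
  ... | inj₁ (_   , eq) rewrite eq = ≤-refl
  ... | inj₂ (x≤0 , eq) rewrite eq = x≤0

  pos-least : ∀ {x b} → x ≤ b → 0# ≤ b → pos x ≤ b
  pos-least {x} x≤b 0≤b with pos-split x
  ... | inj₁ (_ , eq) rewrite eq = x≤b
  ... | inj₂ (_ , eq) rewrite eq = 0≤b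

  pos-mono : ∀ {x y} → x ≤ y → pos x ≤ pos y
  pos-mono {y = y} x≤y = pos-least (≤-trans x≤y (x≤pos y)) (0≤pos y)

  -- `x - pos x` is the minimum of `x` and `0#`.
  x-pos-mono : ∀ {x y} → x ≤ y → x - pos x ≤ y - pos y
  x-pos-mono {x} {y} x≤y = x+d≈y⇒x≤y (≤⇒0≤- posy+x≤posx+y)
    (solve 4 (λ x y X Y → (x :- X) :+ ((X :+ y) :- (Y :+ x)) := y :- Y) refl x y (pos x) (pos y))
    where
    posy+x≤posx+y : pos y + x ≤ pos x + y
    posy+x≤posx+y with pos-split y
    ... | inj₁ (_   , eq) rewrite eq = ≤-respˡ-≈ (+-comm x y) (+-monoˡ-≤ y (x≤pos x))
    ... | inj₂ (_   , eq) rewrite eq = +-mono-≤ (0≤pos x) x≤y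

  pos-complementary : ∀ x → pos x * (pos x - x) ≈ 0#
  pos-complementary x with pos-split x
  ... | inj₁ (_ , eq) rewrite eq = trans (*-congˡ (-‿inverseʳ x)) (zeroʳ x)
  ... | inj₂ (_ , eq) rewrite eq = zeroˡ _

  -- The obtuse-angle criterion for projection onto the half-line: by `pos-complementary` the
  -- product equals `z * (pos x - x)`, whose factors are nonnegative.
  pos-obtuse : ∀ {x z} → 0# ≤ z → 0# ≤ (pos x - x) * (z - pos x)
  pos-obtuse {x} {z} 0≤z = begin
    0#                                       ≤⟨ *-nonNeg 0≤z (≤⇒0≤- (x≤pos x)) ⟩
    z * (P - x)                              ≈⟨ solve 3 (λ P z x → z :* (P :- x) := (P :- x) :* (z :- P) :+ P :* (P :- x)) refl P z x ⟩
    (P - x) * (z - P) + P * (P - x)          ≈⟨ +-congˡ (pos-complementary x) ⟩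
    (P - x) * (z - P) + 0#                   ≈⟨ +-identityʳ _ ⟩
    (P - x) * (z - P)                        ∎
    where P = pos x

module Prox {c ℓ₁ ℓ₂} (ℝ : Reals c ℓ₁ ℓ₂) where
  open Reals ℝ hiding (zero)
  open OWL ℝ
  open OrderedField ℝ
  open IntegerCoefficients commutativeRing using (solve; _:=_; _:+_; _:*_; _:-_; :-_)
  open SemiringSum semiring
    using (sum-cong-≋; sum-cong-≗; sum-remove; sum-replicate-zero; ∑-distrib-+; sum-permute; *-distribˡ-sum)
  open PartialOrderReasoning (DecTotalOrder.poset decTotalOrder)

  private variable
    n : ℕ

  -- Finite sums and squared norms.

  sum-mono : {f g : ℝ^ n} → (∀ i → f i ≤ g i) → sum f ≤ sum g
  sum-mono {zero}  f≤g = ≤-refl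
  sum-mono {suc n} f≤g = +-mono-≤ (f≤g zero) (sum-mono (f≤g ∘ suc))

  sum-nonNeg : {f : ℝ^ n} → (∀ i → 0# ≤ f i) → 0# ≤ sum f
  sum-nonNeg {n} 0≤f = ≤-respˡ-≈ (sum-replicate-zero n) (sum-mono 0≤f)

  term≤sum : {f : ℝ^ n} → (∀ i → 0# ≤ f i) → ∀ i → f i ≤ sum f
  term≤sum {suc n} {f} 0≤f i =
    x+d≈y⇒x≤y (sum-nonNeg (λ j → 0≤f (punchIn i j))) (sym (sum-remove {i = i} f))

  sum-neg : (f : ℝ^ n) → sum (λ i → - f i) ≈ - sum f
  sum-neg {zero}  f = trans (sym (-‿inverseʳ 0#)) (+-identityˡ (- 0#))
  sum-neg {suc n} f = trans (+-congˡ (sum-neg (f ∘ suc)))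
    (solve 2 (λ a s → :- a :+ :- s := :- (a :+ s)) refl (f zero) (sum (f ∘ suc)))

  ‖‖²≤0⇒≈0 : {f : ℝ^ n} → ‖ f ‖² ≤ 0# → ∀ i → f i ≈ 0#
  ‖‖²≤0⇒≈0 {f = f} ‖f‖²≤0 i = x²≤0⇒x≈0 (≤-trans (term≤sum (λ j → 0≤x² (f j)) i) ‖f‖²≤0)

  sum-select : (b x : ℝ^ n) (k : Fin n) → b k ≈ 1# → (∀ j → j ≢ k → b j ≈ 0#) → b ∙ x ≈ x k
  sum-select {suc n} b x k bₖ≈1 b≈0 = begin-equality
    b ∙ x                                           ≈⟨ sum-remove {i = k} (b ⊙ x) ⟩
    b k * x k + sum (removeAt (b ⊙ x) k)            ≈⟨ +-cong (*-congʳ bₖ≈1)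
                                                       (sum-cong-≋ (λ j → *-congʳ (b≈0 (punchIn k j) (Fin.punchInᵢ≢i k j)))) ⟩
    1# * x k + sum (λ j → 0# * x (punchIn k j))     ≈⟨ +-cong (*-identityˡ (x k)) (sum-cong-≋ (λ j → zeroˡ (x (punchIn k j)))) ⟩
    x k + sum {n} (λ _ → 0#)                        ≈⟨ +-congˡ (sum-replicate-zero n) ⟩
    x k + 0#                                        ≈⟨ +-identityʳ (x k) ⟩
    x k                                             ∎

  -- Permutation matrices acting on vectors.

  module _ (π : Permutation′ n) where

    permutationMatrix-≡ : ∀ {i j} → π ⟨$⟩ʳ i ≡ j → permutationMatrix π i j ≈ 1#
    permutationMatrix-≡ {i} {j} πi≡j =
      reflexive (≡.cong (if_then 1# else 0#) (dec-true ((π ⟨$⟩ʳ i) Fin.≟ j) πi≡j))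

    permutationMatrix-≢ : ∀ {i j} → π ⟨$⟩ʳ i ≢ j → permutationMatrix π i j ≈ 0#
    permutationMatrix-≢ {i} {j} πi≢j =
      reflexive (≡.cong (if_then 1# else 0#) (dec-false ((π ⟨$⟩ʳ i) Fin.≟ j) πi≢j))

    module _ {P : Matrix n n} (P≈π : ∀ i j → P i j ≈ permutationMatrix π i j) (x : ℝ^ n) where

      permutationMatrix-*ᵥ : ∀ i → (P *ᵥ x) i ≈ x (π ⟨$⟩ʳ i)
      permutationMatrix-*ᵥ i = sum-select (P i) x (π ⟨$⟩ʳ i)
        (trans (P≈π i _) (permutationMatrix-≡ ≡.refl))
        (λ j j≢ → trans (P≈π i j) (permutationMatrix-≢ (j≢ ∘ ≡.sym)))

      -- Column `i` has its one in row `π ⟨$⟩ˡ i`, so the transpose acts by the inverse permutation.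
      permutationMatrixᵀ-*ᵥ : ∀ i → (P ᵀ *ᵥ x) i ≈ x (π ⟨$⟩ˡ i)
      permutationMatrixᵀ-*ᵥ i = sum-select ((P ᵀ) i) x (π ⟨$⟩ˡ i)
        (trans (P≈π _ i) (permutationMatrix-≡ (inverseʳ π)))
        (λ j j≢ → trans (P≈π j i)
          (permutationMatrix-≢ (λ πj≡i → j≢ (≡.trans (≡.sym (inverseˡ π)) (≡.cong (π ⟨$⟩ˡ_) πj≡i)))))

  -- Sorting and the rearrangement inequality.

  ↓-𝒦ₘ : (x : ℝ^ n) → 𝒦ₘ (x ↓)
  ↓-𝒦ₘ x {i} {j} i≤j = Sorted.lookup-mono-≤ ≥-totalOrder (sort-↗ (List.tabulate x))
    (≡.subst₂ ℕ._≤_ (≡.sym (Fin.toℕ-cast eq i)) (≡.sym (Fin.toℕ-cast eq j)) i≤j)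
    where
    ≥-totalOrder = DecTotalOrder.totalOrder (DecTotalOrderProperties.≥-decTotalOrder decTotalOrder)
    eq = length-sort-tabulate x

  -- The index bijection is read off the proof that `sort` permutes its input; the casts on both
  -- sides identify `Fin n` with the positions of the two lists.
  ↓-permutation : (x : ℝ^ n) → ∃ λ (τ : Permutation′ n) → ∀ i → (x ↓) i ≡ x (τ ⟨$⟩ʳ i)
  ↓-permutation {n} x = cast-id eq₁ ∘ₚ onIndices ↭x ∘ₚ cast-id eq₂ , ↓≡
    where
    eq₁ = length-sort-tabulate x
    eq₂ = List.length-tabulate x
    ↭x  = ↭⇒↭ₛ (sort-↭ (List.tabulate x))
    lookup-tabulate : ∀ k → List.lookup (List.tabulate x) k ≡ x (cast eq₂ k)
    lookup-tabulate k = ≡.trans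
      (≡.cong (List.lookup (List.tabulate x)) (≡.sym (Fin.cast-involutive (≡.sym eq₂) eq₂ k)))
      (List.lookup-tabulate x (cast eq₂ k))
    ↓≡ : ∀ i → (x ↓) i ≡ _
    ↓≡ i = ≡.trans (↭ₛ.onIndices-lookup (≡.setoid Carrier) ↭x (cast eq₁ i))
                   (lookup-tabulate (onIndices ↭x ⟨$⟩ʳ cast eq₁ i))

  -- For a cost with decreasing differences, pairing two non-increasing
  -- vectors index by index is cheapest.  Both the inner product (negated) and
  -- the squared distance are instances.
  module Rearrangement
    (cost : Carrier → Carrier → Carrier)
    (monge : ∀ {a a′ b b′} → a′ ≤ a → b′ ≤ b → cost a b + cost a′ b′ ≤ cost a b′ + cost a′ b)
    where

    -- Induction on `k`: the induction hypothesis on the tails pairs `x₁` with `yₖ`, and one `monge`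
    -- exchange of the partners of `x₀` and `x₁` gives `yₖ` to `x₀`.
    insert-≤ : {x y : ℝ^ (suc n)} → 𝒦ₘ x → 𝒦ₘ y → ∀ k →
               sum (λ i → cost (x i) (y i)) ≤
               cost (x zero) (y k) + sum (λ i → cost (x (suc i)) (y (punchIn k i)))
    insert-≤         x↘ y↘ zero    = ≤-refl
    insert-≤ {suc n} {x} {y} x↘ y↘ (suc k) = begin
      cost x₀ y₀ + sum (λ i → cost (x (suc i)) (y (suc i)))  ≤⟨ +-monoʳ-≤ _ (insert-≤ (x↘ ∘ s≤s) (y↘ ∘ s≤s) k) ⟩
      cost x₀ y₀ + (cost x₁ yₖ + rest)                        ≈⟨ +-assoc _ _ _ ⟨
      (cost x₀ y₀ + cost x₁ yₖ) + rest                        ≤⟨ +-monoˡ-≤ rest (monge (x↘ z≤n) (y↘ z≤n)) ⟩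
      (cost x₀ yₖ + cost x₁ y₀) + rest                        ≈⟨ +-assoc _ _ _ ⟩
      cost x₀ yₖ + (cost x₁ y₀ + rest)                        ∎
      where
      x₀ = x zero
      x₁ = x (suc zero)
      y₀ = y zero
      yₖ = y (suc k)
      rest = sum (λ i → cost (x (suc (suc i))) (y (suc (punchIn k i))))

    -- `insert-≤` fixes the partner of `x zero`. The values left over stay non-increasing because
    -- `punchIn k` is monotone, so induction applies to `remove zero π`.
    rearrange-≤ : {x y : ℝ^ n} → 𝒦ₘ x → 𝒦ₘ y → (π : Permutation′ n) →
                  sum (λ i → cost (x i) (y i)) ≤ sum (λ i → cost (x i) (y (π ⟨$⟩ʳ i)))
    rearrange-≤ {zero}              x↘ y↘ π = ≤-refl
    rearrange-≤ {suc n} {x} {y} x↘ y↘ π = begin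
      sum (λ i → cost (x i) (y i))
        ≤⟨ insert-≤ x↘ y↘ k ⟩
      cost (x zero) (y k) + sum (λ i → cost (x (suc i)) (y (punchIn k i)))
        ≤⟨ +-monoʳ-≤ _ (rearrange-≤ (x↘ ∘ s≤s) (y↘ ∘ Fin.punchIn-mono-≤ k _ _) (remove zero π)) ⟩
      cost (x zero) (y k) + sum (λ i → cost (x (suc i)) (y (punchIn k (remove zero π ⟨$⟩ʳ i))))
        ≡⟨ ≡.cong (cost (x zero) (y k) +_)
             (sum-cong-≗ (λ i → ≡.cong (λ j → cost (x (suc i)) (y j)) (punchIn-permute π zero i))) ⟨
      sum (λ i → cost (x i) (y (π ⟨$⟩ʳ i)))
        ∎
      where k = π ⟨$⟩ʳ zero

    sort-≤ : {x : ℝ^ n} → 𝒦ₘ x → (y : ℝ^ n) (π : Permutation′ n) →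
             sum (λ i → cost (x i) ((y ↓) i)) ≤ sum (λ i → cost (x i) (y (π ⟨$⟩ʳ i)))
    sort-≤ {x = x} x↘ y π with τ , y↓≡ ← ↓-permutation y = begin
      sum (λ i → cost (x i) ((y ↓) i))
        -- The vector `y` permuted by `π` is a rearrangement of `y ↓`, along `π` followed by the
        -- inverse of `τ`.
        ≤⟨ rearrange-≤ x↘ (↓-𝒦ₘ y) (π ∘ₚ flip τ) ⟩
      sum (λ i → cost (x i) ((y ↓) (τ ⟨$⟩ˡ (π ⟨$⟩ʳ i))))
        ≡⟨ sum-cong-≗ (λ i → ≡.cong (cost (x i)) (≡.trans (y↓≡ _) (≡.cong y (inverseʳ τ)))) ⟩
      sum (λ i → cost (x i) (y (π ⟨$⟩ʳ i)))
        ∎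

  -- The gap is twice `(a - a′) * (b - b′)`, whose factors are nonnegative.
  squaredDistance-monge : ∀ {a a′ b b′} → a′ ≤ a → b′ ≤ b →
    (b - a) * (b - a) + (b′ - a′) * (b′ - a′) ≤ (b′ - a) * (b′ - a) + (b - a′) * (b - a′)
  squaredDistance-monge {a} {a′} {b} {b′} a′≤a b′≤b = x+d≈y⇒x≤y (+-nonNeg 0≤d 0≤d)
    (solve 4 (λ a a′ b b′ →
        ((b :- a) :* (b :- a) :+ (b′ :- a′) :* (b′ :- a′)) :+ ((a :- a′) :* (b :- b′) :+ (a :- a′) :* (b :- b′))
        := (b′ :- a) :* (b′ :- a) :+ (b :- a′) :* (b :- a′))
      refl a a′ b b′)
    where
    0≤d : 0# ≤ (a - a′) * (b - b′)
    0≤d = *-nonNeg (≤⇒0≤- a′≤a) (≤⇒0≤- b′≤b)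

  negProduct-monge : ∀ {a a′ b b′} → a′ ≤ a → b′ ≤ b →
    - (a * b) + - (a′ * b′) ≤ - (a * b′) + - (a′ * b)
  negProduct-monge {a} {a′} {b} {b′} a′≤a b′≤b = x+d≈y⇒x≤y (*-nonNeg (≤⇒0≤- a′≤a) (≤⇒0≤- b′≤b))
    (solve 4 (λ a a′ b b′ →
        (:- (a :* b) :+ :- (a′ :* b′)) :+ (a :- a′) :* (b :- b′)
        := :- (a :* b′) :+ :- (a′ :* b))
      refl a a′ b b′)

  module SquaredDistance = Rearrangement (λ a b → (b - a) * (b - a)) squaredDistance-monge
  module NegProduct      = Rearrangement (λ a b → - (a * b)) negProduct-monge

  -- Turns the minimal cost in `NegProduct` into a maximal inner product.
  sum-neg-reverses-≤ : (f g : ℝ^ n) → sum (λ i → - f i) ≤ sum (λ i → - g i) → sum g ≤ sum f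
  sum-neg-reverses-≤ f g -f≤-g = begin
    sum g                   ≈⟨ solve 1 (λ s → :- (:- s) := s) refl (sum g) ⟨
    - - sum g               ≈⟨ -‿cong (sum-neg g) ⟨
    - sum (λ i → - g i)     ≤⟨ neg-antimono-≤ -f≤-g ⟩
    - sum (λ i → - f i)     ≈⟨ -‿cong (sum-neg f) ⟩
    - - sum f               ≈⟨ solve 1 (λ s → :- (:- s) := s) refl (sum f) ⟩
    sum f                   ∎

  -- Summing `pos-obtuse` gives a Pythagorean inequality at `p⁺`. Since `q` is no farther from `p`
  -- than `p⁺` is, the squared distance from `q` to `p⁺` is at most zero.
  pos-proj-ℝ₊ : {p q : ℝ^ n} → IsProj ℝ₊ p q → ∀ i → q i ≈ pos (p i)
  pos-proj-ℝ₊ {n} {p} {q} (0≤q , q-closest) i =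
    x-y≈0⇒x≈y (‖‖²≤0⇒≈0 (+-cancelˡ-≤ ‖ p⁺ -ᵥ p ‖² (begin
      ‖ p⁺ -ᵥ p ‖² + ‖ q -ᵥ p⁺ ‖²     ≈⟨ ∑-distrib-+ (λ i → (p⁺ -ᵥ p) i * (p⁺ -ᵥ p) i) _ ⟨
      sum (λ i → (p⁺ -ᵥ p) i * (p⁺ -ᵥ p) i + (q -ᵥ p⁺) i * (q -ᵥ p⁺) i)
                                       ≤⟨ sum-mono pythagoras ⟩
      ‖ q -ᵥ p ‖²                     ≤⟨ q-closest p⁺ (0≤pos ∘ p) ⟩
      ‖ p⁺ -ᵥ p ‖²                    ≈⟨ +-identityʳ _ ⟨
      ‖ p⁺ -ᵥ p ‖² + 0#               ∎)) i)
    where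
    p⁺ : ℝ^ n
    p⁺ = pos ∘ p
    pythagoras : ∀ i → (p⁺ -ᵥ p) i * (p⁺ -ᵥ p) i + (q -ᵥ p⁺) i * (q -ᵥ p⁺) i ≤ (q -ᵥ p) i * (q -ᵥ p) i
    pythagoras i = x+d≈y⇒x≤y (+-nonNeg 0≤d 0≤d)
      (solve 3 (λ P p q → ((P :- p) :* (P :- p) :+ (q :- P) :* (q :- P)) :+ ((P :- p) :* (q :- P) :+ (P :- p) :* (q :- P))
        := (q :- p) :* (q :- p)) refl (p⁺ i) (p i) (q i))
      where
      0≤d = pos-obtuse {p i} (0≤q i)

  ∙-permute-≤ : {w u : ℝ^ n} → 𝒦ₘ w → 𝒦ₘ u → (π : Permutation′ n) → w ∙ (u ∘ (π ⟨$⟩ʳ_)) ≤ w ∙ u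
  ∙-permute-≤ {w = w} {u} w↘ u↘ π = sum-neg-reverses-≤ (w ⊙ u) (w ⊙ (u ∘ (π ⟨$⟩ʳ_)))
    (NegProduct.rearrange-≤ w↘ u↘ π)

  -- The upper-bound half of writing `Ω w x` as a maximum over permutations; the convexity of `Ω w`
  -- rests on it.
  ∙-permute-≤-Ω : {w : ℝ^ n} → 𝒦ₘ w → (x : ℝ^ n) (π : Permutation′ n) → w ∙ (∣ x ∣ ∘ (π ⟨$⟩ʳ_)) ≤ Ω w x
  ∙-permute-≤-Ω {w = w} w↘ x π = sum-neg-reverses-≤ (w ⊙ ∣ x ∣ ↓) (w ⊙ (∣ x ∣ ∘ (π ⟨$⟩ʳ_)))
    (NegProduct.sort-≤ w↘ ∣ x ∣ π)

  -- The prox objective compared with its sorted counterpart.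

  module Objective {n} (w v : ℝ^ n) where

    private
      a : ℝ^ n
      a = ∣ v ∣ ↓

    -- These are `f` and `g` of the outline. On `𝒦ₘ₊` the linear term `w ∙ u` agrees with `Ω w u`.
    proxObjective sortedObjective : ℝ^ n → Carrier
    proxObjective   x = ½ * ‖ x -ᵥ v ‖² + Ω w x
    sortedObjective u = ½ * ‖ u -ᵥ a ‖² + w ∙ u

    -- The penalty terms coincide by definition of `Ω`, so only distances are compared: sorting both
    -- moduli brings them closer than pairing them by `τ`, which is the original pairing reindexed,
    -- and taking moduli does not increase distances.
    sortedObjective-↓-≤ : ∀ y → sortedObjective (∣ y ∣ ↓) ≤ proxObjective y
    sortedObjective-↓-≤ y with τ , a≡ ← ↓-permutation ∣ v ∣ =
      +-monoˡ-≤ (Ω w y) (*-monoˡ-≤-nonNeg 0≤½ (begin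
        ‖ ∣ y ∣ ↓ -ᵥ a ‖²
          ≤⟨ SquaredDistance.sort-≤ (↓-𝒦ₘ ∣ v ∣) ∣ y ∣ τ ⟩
        sum (λ i → (abs (y (τ ⟨$⟩ʳ i)) - a i) * (abs (y (τ ⟨$⟩ʳ i)) - a i))
          ≡⟨ sum-cong-≗ (λ i → ≡.cong (λ b → (abs (y (τ ⟨$⟩ʳ i)) - b) * (abs (y (τ ⟨$⟩ʳ i)) - b)) (a≡ i)) ⟩
        sum (λ i → (∣ y ∣ -ᵥ ∣ v ∣) (τ ⟨$⟩ʳ i) * (∣ y ∣ -ᵥ ∣ v ∣) (τ ⟨$⟩ʳ i))
          ≈⟨ sum-permute (λ i → (∣ y ∣ -ᵥ ∣ v ∣) i * (∣ y ∣ -ᵥ ∣ v ∣) i) τ ⟨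
        ‖ ∣ y ∣ -ᵥ ∣ v ∣ ‖²
          ≤⟨ sum-mono (λ i → [absx-absy]²≤[x-y]² (y i) (v i)) ⟩
        ‖ y -ᵥ v ‖²
          ∎))

    module _ {p : ℝ^ n} (proj : IsProj 𝒦ₘ (a -ᵥ w) p) where

      private
        p⁺ : ℝ^ n
        p⁺ = pos ∘ p

      ½‖‖²+w∙≈sum : ∀ f u → ½ * ‖ f ‖² + w ∙ u ≈ sum (λ i → ½ * (f i * f i) + w i * u i)
      ½‖‖²+w∙≈sum f u = trans (+-congʳ (*-distribˡ-sum ½ (f ⊙ f)))
                              (sym (∑-distrib-+ (λ i → ½ * (f i * f i)) (w ⊙ u)))

      -- Moving p by u - p⁺ stays in 𝒦ₘ because t ↦ t - pos t is monotone,
      -- and p is closest to z = a - w there.  The change of the objective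
      -- from p⁺ to u exceeds that of ½ ‖ · - z ‖² along this move by
      -- (p⁺ - p) ∙ (u - p⁺) ≥ 0.
      sortedObjective-minimal : ∀ {u} → 𝒦ₘ u → ℝ₊ u → sortedObjective p⁺ ≤ sortedObjective u
      sortedObjective-minimal {u} u↘ 0≤u = +-cancelˡ-≤ (½ * ‖ p -ᵥ z ‖²) (begin
        ½ * ‖ p -ᵥ z ‖² + sortedObjective p⁺
          ≤⟨ +-monoˡ-≤ _ (*-monoˡ-≤-nonNeg 0≤½ (proj₂ proj y y↘)) ⟩
        ½ * ‖ y -ᵥ z ‖² + sortedObjective p⁺
          ≈⟨ asSum y p⁺ ⟩
        sum (λ i → term y p⁺ i)
          ≤⟨ sum-mono term-≤ ⟩
        sum (λ i → term p u i)
          ≈⟨ asSum p u ⟨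
        ½ * ‖ p -ᵥ z ‖² + sortedObjective u
          ∎)
        where
        z y : ℝ^ n
        z = a -ᵥ w
        y i = u i + (p i - p⁺ i)

        y↘ : 𝒦ₘ y
        y↘ i≤j = +-mono-≤ (u↘ i≤j) (x-pos-mono (proj₁ proj i≤j))

        term : ℝ^ n → ℝ^ n → ℝ^ n
        term s t i = ½ * ((s -ᵥ z) i * (s -ᵥ z) i) + (½ * ((t -ᵥ a) i * (t -ᵥ a) i) + w i * t i)

        asSum : ∀ s t → ½ * ‖ s -ᵥ z ‖² + sortedObjective t ≈ sum (term s t)
        asSum s t = trans
          (+-cong (*-distribˡ-sum ½ ((s -ᵥ z) ⊙ (s -ᵥ z))) (½‖‖²+w∙≈sum (t -ᵥ a) t))
          (sym (∑-distrib-+ (λ i → ½ * ((s -ᵥ z) i * (s -ᵥ z) i)) _))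

        -- The identity uses 2 · ½ = 1 once, on the multiple K.
        term-≤ : ∀ i → term y p⁺ i ≤ term p u i
        term-≤ i = x+d≈y⇒x≤y (pos-obtuse {p i} (0≤u i)) (begin-equality
          term y p⁺ i + (P - p i) * (U - P)
            ≈⟨ solve 6 (λ h p P U a w →
                 let K = (U :- P) :* ((P :- p) :- w)
                     z = a :- w
                     y = U :+ (p :- P)
                 in
                 (h :* ((y :- z) :* (y :- z)) :+ (h :* ((P :- a) :* (P :- a)) :+ w :* P)) :+ (P :- p) :* (U :- P)
                 := (h :* ((p :- z) :* (p :- z)) :+ (h :* ((U :- a) :* (U :- a)) :+ w :* U)) :+ (K :- h :* (K :+ K)))
                 refl ½ (p i) P U (a i) (w i) ⟩
          term p u i + (K - ½ * (K + K))   ≈⟨ +-congˡ (+-congˡ (-‿cong (½[x+x]≈x K))) ⟩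
          term p u i + (K - K)             ≈⟨ +-congˡ (-‿inverseʳ K) ⟩
          term p u i + 0#                  ≈⟨ +-identityʳ _ ⟩
          term p u i                       ∎)
          where
          P = p⁺ i
          U = u i
          -- Both squared distances change along the same displacement `U - P`, so its square
          -- cancels and the cross terms leave `½ * (K + K)`.
          K = (U - P) * ((P - p i) - w i)

      sortedObjective-≤-proxObjective : ∀ y → sortedObjective p⁺ ≤ proxObjective y
      sortedObjective-≤-proxObjective y with τ , y↓≡ ← ↓-permutation ∣ y ∣ = ≤-trans
        (sortedObjective-minimal (↓-𝒦ₘ ∣ y ∣)
          (λ i → ≤-trans (0≤abs (y (τ ⟨$⟩ʳ i))) (≤-reflexive (reflexive (≡.sym (y↓≡ i))))))
        (sortedObjective-↓-≤ y)

      module _ (w∈𝒦ₘ₊ : 𝒦ₘ₊ w)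
               (π : Permutation′ n) (a≈ : ∀ i → a i ≈ abs (v (π ⟨$⟩ʳ i)))
               {x : ℝ^ n} (x≈ : ∀ i → x i ≈ sgn (v i) * p⁺ (π ⟨$⟩ˡ i)) where

        -- Distance and penalty are bounded separately, by inequalities because a zero entry of `v`
        -- forces a zero entry of `x`. The lower bound `sortedObjective-≤-proxObjective` closes the
        -- gap.
        proxObjective-≤-sortedObjective : proxObjective x ≤ sortedObjective p⁺
        proxObjective-≤-sortedObjective = +-mono-≤ (*-monoˡ-≤-nonNeg 0≤½ dist) Ωx≤
          where
          dist : ‖ x -ᵥ v ‖² ≤ ‖ p⁺ -ᵥ a ‖²
          dist = begin
            ‖ x -ᵥ v ‖²
              ≤⟨ sum-mono (λ i → [sgn*-v]²≤[b-absv]² (v i) (x≈ i)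
                   (trans (a≈ (π ⟨$⟩ˡ i)) (reflexive (≡.cong (abs ∘ v) (inverseʳ π))))) ⟩
            sum (λ i → (p⁺ -ᵥ a) (π ⟨$⟩ˡ i) * (p⁺ -ᵥ a) (π ⟨$⟩ˡ i))
              ≈⟨ sum-permute (λ i → (p⁺ -ᵥ a) i * (p⁺ -ᵥ a) i) (flip π) ⟨
            ‖ p⁺ -ᵥ a ‖²
              ∎

          -- Nonnegativity of `w` allows replacing moduli of `x` by the permuted entries of `p⁺`;
          -- monotonicity of `w` and `p⁺` then makes the unpermuted pairing the largest.
          Ωx≤ : Ω w x ≤ w ∙ p⁺
          Ωx≤ with τ , x↓≡ ← ↓-permutation ∣ x ∣ = begin
            Ω w x
              ≡⟨ sum-cong-≗ (λ i → ≡.cong (w i *_) (x↓≡ i)) ⟩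
            w ∙ (∣ x ∣ ∘ (τ ⟨$⟩ʳ_))
              ≤⟨ sum-mono (λ i → *-monoˡ-≤-nonNeg (proj₂ w∈𝒦ₘ₊ i)
                   (abs-sgn* (v (τ ⟨$⟩ʳ i)) (0≤pos _) (x≈ (τ ⟨$⟩ʳ i)))) ⟩
            w ∙ (p⁺ ∘ (τ ∘ₚ flip π ⟨$⟩ʳ_))
              ≤⟨ ∙-permute-≤ (proj₁ w∈𝒦ₘ₊) (pos-mono ∘ proj₁ proj) (τ ∘ₚ flip π) ⟩
            w ∙ p⁺
              ∎

    -- Strict convexity and uniqueness of the minimizer.

    module _ (w∈𝒦ₘ₊ : 𝒦ₘ₊ w) (x y : ℝ^ n) where

      private
        m d : ℝ^ n
        m i = ½ * x i + ½ * y i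
        d i = ½ * x i - ½ * y i

      -- The permutation sorting the modulus of `m` is used for `x` and `y` as well: `abs-midpoint`
      -- applies entrywise, and the resulting pairings are bounded by `Ω w x` and `Ω w y`.
      Ω-midpoint : Ω w m + Ω w m ≤ Ω w x + Ω w y
      Ω-midpoint with τ , m↓≡ ← ↓-permutation ∣ m ∣ = begin
        Ω w m + Ω w m
          ≡⟨ ≡.cong (λ s → s + s) (sum-cong-≗ (λ i → ≡.cong (w i *_) (m↓≡ i))) ⟩
        w ∙ (∣ m ∣ ∘ (τ ⟨$⟩ʳ_)) + w ∙ (∣ m ∣ ∘ (τ ⟨$⟩ʳ_))
          ≈⟨ ∑-distrib-+ (λ i → w i * abs (m (τ ⟨$⟩ʳ i))) _ ⟨
        sum (λ i → w i * abs (m (τ ⟨$⟩ʳ i)) + w i * abs (m (τ ⟨$⟩ʳ i)))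
          ≤⟨ sum-mono (λ i → step (proj₂ w∈𝒦ₘ₊ i) (abs-midpoint (2m (τ ⟨$⟩ʳ i)))) ⟩
        sum (λ i → w i * abs (x (τ ⟨$⟩ʳ i)) + w i * abs (y (τ ⟨$⟩ʳ i)))
          ≈⟨ ∑-distrib-+ (λ i → w i * abs (x (τ ⟨$⟩ʳ i))) _ ⟩
        w ∙ (∣ x ∣ ∘ (τ ⟨$⟩ʳ_)) + w ∙ (∣ y ∣ ∘ (τ ⟨$⟩ʳ_))
          ≤⟨ +-mono-≤ (∙-permute-≤-Ω (proj₁ w∈𝒦ₘ₊) x τ) (∙-permute-≤-Ω (proj₁ w∈𝒦ₘ₊) y τ) ⟩
        Ω w x + Ω w y
          ∎
        where
        2m : ∀ i → m i + m i ≈ x i + y i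
        2m i = trans (solve 2 (λ s t → (s :+ t) :+ (s :+ t) := (s :+ s) :+ (t :+ t)) refl (½ * x i) (½ * y i))
                     (+-cong (½x+½x≈x (x i)) (½x+½x≈x (y i)))
        step : ∀ {r s t u} → 0# ≤ r → s + s ≤ t + u → r * s + r * s ≤ r * t + r * u
        step {r} {s} {t} {u} 0≤r 2s≤t+u =
          ≤-respˡ-≈ (distribˡ r s s) (≤-respʳ-≈ (distribˡ r t u) (*-monoˡ-≤-nonNeg 0≤r 2s≤t+u))

      -- Entrywise, `x - v` is `(m - v) + d` and `y - v` is `(m - v) - d`.
      parallelogram : ‖ x -ᵥ v ‖² + ‖ y -ᵥ v ‖² ≈
                      (‖ m -ᵥ v ‖² + ‖ d ‖²) + (‖ m -ᵥ v ‖² + ‖ d ‖²)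
      parallelogram = begin-equality
        ‖ x -ᵥ v ‖² + ‖ y -ᵥ v ‖²
          ≈⟨ ∑-distrib-+ (λ i → (x -ᵥ v) i * (x -ᵥ v) i) _ ⟨
        sum (λ i → (x -ᵥ v) i * (x -ᵥ v) i + (y -ᵥ v) i * (y -ᵥ v) i)
          ≈⟨ sum-cong-≋ pointwise ⟩
        sum (λ i → M i + D i + (M i + D i))
          ≈⟨ ∑-distrib-+ (λ i → M i + D i) _ ⟩
        sum (λ i → M i + D i) + sum (λ i → M i + D i)
          ≈⟨ +-cong (∑-distrib-+ M D) (∑-distrib-+ M D) ⟩
        (‖ m -ᵥ v ‖² + ‖ d ‖²) + (‖ m -ᵥ v ‖² + ‖ d ‖²)
          ∎
        where
        M D : ℝ^ n
        M = (m -ᵥ v) ⊙ (m -ᵥ v)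
        D = d ⊙ d
        pointwise : ∀ i → (x -ᵥ v) i * (x -ᵥ v) i + (y -ᵥ v) i * (y -ᵥ v) i ≈ M i + D i + (M i + D i)
        pointwise i = trans
          -- Splitting each entry into two halves lets the solver treat the halves as atoms, with no
          -- appeal to the value of `½`.
          (+-cong (square-cong (+-congʳ (sym (½x+½x≈x (x i))))) (square-cong (+-congʳ (sym (½x+½x≈x (y i))))))
          (solve 3 (λ s t v →
              ((s :+ s) :- v) :* ((s :+ s) :- v) :+ ((t :+ t) :- v) :* ((t :+ t) :- v)
              := let M = ((s :+ t) :- v) :* ((s :+ t) :- v)
                     D = (s :- t) :* (s :- t)
                 in (M :+ D) :+ (M :+ D))
            refl (½ * x i) (½ * y i) (v i))

      -- Strong convexity at the midpoint: the surplus `‖ d ‖²` comes from the parallelogram law,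
      -- while `Ω w` contributes plain convexity.
      proxObjective-midpoint : (proxObjective m + proxObjective m) + ‖ d ‖² ≤ proxObjective x + proxObjective y
      proxObjective-midpoint = begin
        ((½ * A + Ωm) + (½ * A + Ωm)) + ‖ d ‖²
          ≈⟨ solve 3 (λ hA O D → ((hA :+ O) :+ (hA :+ O)) :+ D := ((hA :+ hA) :+ D) :+ (O :+ O)) refl (½ * A) Ωm ‖ d ‖² ⟩
        ((½ * A + ½ * A) + ‖ d ‖²) + (Ωm + Ωm)
          ≤⟨ +-mono-≤ (≤-reflexive quadratic) Ω-midpoint ⟩
        ½ * (X + Y) + (Ω w x + Ω w y)
          ≈⟨ solve 5 (λ h X Y O Q → h :* (X :+ Y) :+ (O :+ Q) := (h :* X :+ O) :+ (h :* Y :+ Q)) refl ½ X Y (Ω w x) (Ω w y) ⟩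
        proxObjective x + proxObjective y
          ∎
        where
        A = ‖ m -ᵥ v ‖²
        X = ‖ x -ᵥ v ‖²
        Y = ‖ y -ᵥ v ‖²
        Ωm = Ω w m
        quadratic : (½ * A + ½ * A) + ‖ d ‖² ≈ ½ * (X + Y)
        quadratic = begin-equality
          (½ * A + ½ * A) + ‖ d ‖²              ≈⟨ +-congʳ (½x+½x≈x A) ⟩
          A + ‖ d ‖²                            ≈⟨ ½[x+x]≈x (A + ‖ d ‖²) ⟨
          ½ * ((A + ‖ d ‖²) + (A + ‖ d ‖²))     ≈⟨ *-congˡ parallelogram ⟨
          ½ * (X + Y)                           ∎

      -- The value at `m` is at least `μ` and those at `x` and `y` are at most `μ`, so the midpoint
      -- inequality forces `‖ d ‖²` down to zero.
      proxObjective-minimizer-unique :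
        ∀ {μ} → (∀ z → μ ≤ proxObjective z) → proxObjective x ≤ μ → proxObjective y ≤ μ → x ≋ y
      proxObjective-minimizer-unique {μ} μ≤ x≤μ y≤μ i = begin-equality
        x i                    ≈⟨ ½x+½x≈x (x i) ⟨
        ½ * x i + ½ * x i      ≈⟨ +-cong ½x≈½y ½x≈½y ⟩
        ½ * y i + ½ * y i      ≈⟨ ½x+½x≈x (y i) ⟩
        y i                    ∎
        where
        ‖d‖²≤0 : ‖ d ‖² ≤ 0#
        ‖d‖²≤0 = +-cancelˡ-≤ (μ + μ) (begin
          (μ + μ) + ‖ d ‖²                                  ≤⟨ +-monoˡ-≤ ‖ d ‖² (+-mono-≤ (μ≤ m) (μ≤ m)) ⟩
          (proxObjective m + proxObjective m) + ‖ d ‖²      ≤⟨ proxObjective-midpoint ⟩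
          proxObjective x + proxObjective y                 ≤⟨ +-mono-≤ x≤μ y≤μ ⟩
          μ + μ                                             ≈⟨ +-identityʳ _ ⟨
          (μ + μ) + 0#                                      ∎)
        ½x≈½y : ½ * x i ≈ ½ * y i
        ½x≈½y = x-y≈0⇒x≈y (‖‖²≤0⇒≈0 ‖d‖²≤0 i)

-- The minimum value of the prox objective and the point attaining it.

mainTheorem4 : ∀ {c ℓ₁ ℓ₂ : Level} (ℝ : Reals c ℓ₁ ℓ₂) → let open OWL ℝ in
    ∀ (n : ℕ) (w : ℝ^ n) → 𝒦ₘ₊ w →
    ∀ (v : ℝ^ n) (P : Matrix n n) → IsPermutationMatrix P → ∣ v ∣ ↓ ≋ P *ᵥ ∣ v ∣ →
    ∀ (p q : ℝ^ n) → IsProj 𝒦ₘ (∣ v ∣ ↓ -ᵥ w) p → IsProj ℝ₊ p q →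
    ∀ (x : ℝ^ n) → IsProx (Ω w) v x ⇔ x ≋ sign v ⊙ (P ᵀ *ᵥ q)
mainTheorem4 ℝ n w w∈𝒦ₘ₊ v P (π , P≈π) a≋P∣v∣ p q p-proj q-proj x =
  mk⇔ isProx⇒≋ ≋⇒isProx
  where
  open Reals ℝ
  open OWL ℝ
  open OrderedField ℝ
  open Prox ℝ
  open Objective w v

  minimum : Carrier
  minimum = sortedObjective (pos ∘ p)

  minimum≤ : ∀ y → minimum ≤ proxObjective y
  minimum≤ = sortedObjective-≤-proxObjective p-proj

  -- Stated for every `y` equal to the formula up to `≋`, so that it covers both `x` and the formula
  -- itself.
  ≋⇒≤minimum : ∀ {y} → y ≋ sign v ⊙ (P ᵀ *ᵥ q) → proxObjective y ≤ minimum
  ≋⇒≤minimum y≋ = proxObjective-≤-sortedObjective p-proj w∈𝒦ₘ₊ π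
    (λ i → trans (a≋P∣v∣ i) (permutationMatrix-*ᵥ π P≈π ∣ v ∣ i))
    (λ i → trans (y≋ i) (*-congˡ (trans (permutationMatrixᵀ-*ᵥ π P≈π q i) (pos-proj-ℝ₊ q-proj (π ⟨$⟩ˡ i)))))

  isProx⇒≋ : IsProx (Ω w) v x → x ≋ sign v ⊙ (P ᵀ *ᵥ q)
  isProx⇒≋ (_ , x-minimal) = proxObjective-minimizer-unique w∈𝒦ₘ₊ x (sign v ⊙ (P ᵀ *ᵥ q)) minimum≤
    -- A proximal point does no worse than the formula, whose value is at most the common lower
    -- bound `minimum`.
    (≤-trans (x-minimal _ _) attained) attained
    where
    attained = ≋⇒≤minimum (λ _ → refl)

  ≋⇒isProx : x ≋ sign v ⊙ (P ᵀ *ᵥ q) → IsProx (Ω w) v x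
  ≋⇒isProx x≋ = _ , λ y _ → ≤-trans (≋⇒≤minimum x≋) (minimum≤ y)
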